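{- Let $\varphi$ be an $\mathrm{InqLTL}({\sim})$ formula over $AP$. Then, for each uncountable team $\mathcal L_u$ with $\mathcal L_u\models\varphi$, there is a countable team $\mathcal L_c$ with $\mathcal L_c\models\varphi$ such that $\mathcal L_c\subseteq\mathcal L_u$ and, for each team $\mathcal L$ with $\mathcal L_c\subseteq\mathcal L\subseteq\mathcal L_u$, it holds that $\mathcal L\models\varphi$.
   Context: $AP$ is a fixed finite set of atomic propositions. A trace is an infinite word $w$ over $2^{AP}$; $w(i)$ ($i\ge 0$) is its $(i+1)$-th letter and $w_{\ge i}=w(i)w(i+1)\cdots$. A team is a (possibly empty) set $\mathcal L$ of traces, and $\mathcal L_{\ge i}=\{w_{\ge i}\mid w\in\mathcal L\}$. $\mathrm{InqLTL}({\sim})$ formulas over $AP$ are given by $\varphi::=\bot\mid p\mid \varphi\vee_b\varphi\mid\varphi\wedge\varphi\mid\varphi\to\varphi\mid \mathsf X\varphi\mid\varphi\,\mathsf U\,\varphi\mid\varphi\,\mathsf R\,\varphi\mid{\sim}\varphi$, with $p\in AP$. Satisfaction by a team $\mathcal L$: - $\mathcal L\models\bot$ iff $\mathcal L=\emptyset$; - $\mathcal L\models p$ iff $p\in w(0)$ for each $w\in\mathcal L$; - $\mathcal L\models\varphi_1\vee_b\varphi_2$ (Boolean disjunction) iff $\mathcal L\models\varphi_1$ or $\mathcal L\models\varphi_2$; - $\mathcal L\models\varphi_1\wedge\varphi_2$ iff $\mathcal L\models\varphi_1$ and $\mathcal L\models\varphi_2$; - $\mathcal L\models\varphi_1\to\varphi_2$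 iff for all $\mathcal L'\subseteq\mathcal L$, $\mathcal L'\models\varphi_1$ implies $\mathcal L'\models\varphi_2$; - $\mathcal L\models\mathsf X\varphi$ iff $\mathcal L_{\ge1}\models\varphi$; - $\mathcal L\models\varphi_1\mathsf U\varphi_2$ iff for some $i\ge0$, $\mathcal L_{\ge i}\models\varphi_2$ and $\mathcal L_{\ge k}\models\varphi_1$ for all $0\le k<i$; - $\mathcal L\models\varphi_1\mathsf R\varphi_2$ iff for each $i\ge0$, $\mathcal L_{\ge i}\models\varphi_2$ or $\mathcal L_{\ge k}\models\varphi_1$ for some $0\le k<i$; - $\mathcal L\models{\sim}\varphi$ iff $\mathcal L\not\models\varphi$. A model of $\varphi$ is a team satisfying $\varphi$. Countable means finite or countably infinite. -}

module Defs where

open import Data.Fin using (Fin)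
open import Data.Fin.Subset using (Subset) renaming (_∈_ to _∈ₛ_)
open import Data.Nat using (ℕ; _+_; _<_)
open import Data.Product using (∃-syntax; Σ-syntax; _×_; _,_; proj₁)
open import Data.Sum using (_⊎_)
open import Function.Bundles using (Bijection)
open import Level using (0ℓ; Lift) renaming (suc to lsuc)
open import Relation.Binary using (Setoid; _Respects_)
import Relation.Binary.Construct.On as On
open import Relation.Binary.PropositionalEquality
  using (_≗_; setoid; _→-setoid_; sym; trans)
open import Relation.Nullary using (¬_)
open import Relation.Unary using (Pred; Empty)
import Relation.Unary as U

-- The atomic propositions are the elements of Fin n.

Trace : ℕ → Set
Trace n = ℕ → Subset n

suffix : ∀ {n} → ℕ → Trace n → Trace n
suffix i w j = w (i + j)

-- Function extensionality is not available, so equality of traces is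
-- pointwise equality, and a set of traces is a predicate respecting it.

record Team (n : ℕ) : Set₁ where
  field
    member : Pred (Trace n) 0ℓ
    resp   : member Respects _≗_

open Team public

infix 4 _∈_ _⊆_

_∈_ : ∀ {n} → Trace n → Team n → Set
w ∈ L = member L w

_⊆_ : ∀ {n} → Team n → Team n → Set
L ⊆ L′ = member L U.⊆ member L′

infixl 20 _≥[_]

_≥[_] : ∀ {n} → Team n → ℕ → Team n
L ≥[ i ] = record
  { member = λ v → ∃[ w ] (w ∈ L × v ≗ suffix i w)
  ; resp   = λ v≗v′ (w , w∈L , v≗w) →
               w , w∈L , λ j → trans (sym (v≗v′ j)) (v≗w j)
  }

elements : ∀ {n} → Team n → Setoid 0ℓ 0ℓ
elements {n} L = On.setoid {B = Σ[ w ∈ Trace n ] w ∈ L} (ℕ →-setoid Subset n) proj₁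

Finite : ∀ {n} → Team n → Set
Finite L = ∃[ k ] Bijection (setoid (Fin k)) (elements L)

CountablyInfinite : ∀ {n} → Team n → Set
CountablyInfinite L = Bijection (setoid ℕ) (elements L)

Countable : ∀ {n} → Team n → Set
Countable L = Finite L ⊎ CountablyInfinite L

Uncountable : ∀ {n} → Team n → Set
Uncountable L = ¬ Countable L

infixr 5 _⇒_
infixr 6 _∨ᵇ_
infixr 7 _∧_
infixr 8 _𝖴_ _𝖱_
infix  9 𝖷_ ∼_

data Formula (n : ℕ) : Set where
  bot  : Formula n
  atom : Fin n → Formula n
  _∨ᵇ_ : Formula n → Formula n → Formula n
  _∧_  : Formula n → Formula n → Formula n
  _⇒_  : Formula n → Formula n → Formula n
  𝖷_   : Formula n → Formula n
  _𝖴_  : Formula n → Formula n → Formula n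
  _𝖱_  : Formula n → Formula n → Formula n
  ∼_   : Formula n → Formula n

infix 4 _⊨_

_⊨_ : ∀ {n} → Team n → Formula n → Set₁
L ⊨ bot      = Lift (lsuc 0ℓ) (Empty (member L))
L ⊨ atom p   = Lift (lsuc 0ℓ) (∀ w → w ∈ L → p ∈ₛ w 0)
L ⊨ φ ∨ᵇ ψ   = L ⊨ φ ⊎ L ⊨ ψ
L ⊨ φ ∧ ψ    = L ⊨ φ × L ⊨ ψ
L ⊨ φ ⇒ ψ    = ∀ L′ → L′ ⊆ L → L′ ⊨ φ → L′ ⊨ ψ
L ⊨ 𝖷 φ      = L ≥[ 1 ] ⊨ φ
L ⊨ φ 𝖴 ψ    = ∃[ i ] (L ≥[ i ] ⊨ ψ × (∀ k → k < i → L ≥[ k ] ⊨ φ))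
L ⊨ φ 𝖱 ψ    = ∀ i → L ≥[ i ] ⊨ ψ ⊎ ∃[ k ] (k < i × L ≥[ k ] ⊨ φ)
L ⊨ ∼ φ      = ¬ (L ⊨ φ)

{-# OPTIONS --safe #-}
-- By induction on φ, every team L, countable or not, contains a countable set
-- of traces (a seed) such that all teams between the seed and L agree with L
-- on φ.  If L violates φ ⇒ ψ because of a subteam L₁, a seed of L₁ for φ and ψ
-- suffices: a team L′ above the seed violates φ ⇒ ψ because of L′ ∩ L₁.  For
-- the temporal operators, traces of L are chosen whose suffixes form seeds of
-- all the teams L ≥[ i ].  Finally, since Lᵤ is infinite, a seed of Lᵤ can be
-- padded to an injective sequence of traces of Lᵤ.
--
-- ExcludedMiddle decides types rather than mere propositions, so it also
-- supplies all choices of witnesses.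
module Submission where

open import Defs
open import Axiom.ExcludedMiddle using (ExcludedMiddle)
open import Data.Fin using (zero; suc)
open import Data.Fin.Subset using () renaming (_∈_ to _∈ₛ_)
open import Data.List using (List; []; _∷_; length; lookup; deduplicate)
import Data.List.Membership.Setoid as Membership
open import Data.List.Membership.Setoid.Properties using (∈-lookup)
open import Data.List.Relation.Unary.All using (lookupₛ) renaming (All to ListAll)
open import Data.List.Relation.Unary.AllPairs using (_∷_)
open import Data.List.Relation.Unary.Any using (here; there)
open import Data.List.Relation.Unary.Enumerates.Setoid using (IsEnumeration)
open import Data.List.Relation.Unary.Enumerates.Setoid.Properties
  using (lookup-surjective; deduplicate⁺)
import Data.List.Relation.Unary.Unique.Setoid as Unique
open import Data.List.Relation.Unary.Unique.DecSetoid.Properties using (deduplicate-!)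
open import Data.Maybe using (Maybe; just; nothing; map)
open import Data.Maybe.Relation.Unary.All as All using (All; just; nothing; drop-just)
open import Data.Maybe.Relation.Unary.All.Properties using (map⁻)
open import Data.Nat using (ℕ; zero; suc; _+_; _<_)
open import Data.Nat.Properties using (<-cmp; m<1+n⇒m<n∨m≡n; +-identityʳ; +-suc)
open import Data.Product as Product
  using (∃-syntax; Σ-syntax; _×_; _,_; proj₁; proj₂; map₁; map₂; uncurry)
open import Data.Product.Function.NonDependent.Propositional using (_×-⇔_)
open import Data.Sum as Sum using (inj₁; inj₂)
open import Data.Sum.Function.Propositional using (_⊎-⇔_)
open import Function using (_∘_; id; const)
open import Function.Bundles using (_⇔_; mk⇔; module Equivalence)
open import Function.Related.TypeIsomorphisms using (¬-cong-⇔)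
open import Function.Definitions using (Injective)
open import Level using (0ℓ; Lift; lift; lower) renaming (suc to lsuc)
open import Relation.Binary using (Setoid; DecSetoid; tri<; tri≈; tri>)
open import Relation.Binary.PropositionalEquality
  using (_≡_; _≗_; refl; sym; trans; cong; subst)
open import Relation.Nullary using (¬_; yes; no; contradiction)
open import Relation.Nullary.Decidable as Dec using (decidable-stable)
open import Relation.Unary using (Pred)
import Relation.Unary as U

open Equivalence using (to; from)

-- Duplicate-free lists as injections from `Fin`.

module _ (S : Setoid 0ℓ 0ℓ) where
  private module S = Setoid S

  lookup≉ : ∀ {x xs} → ListAll (λ y → ¬ x S.≈ y) xs → ∀ i → ¬ x S.≈ lookup xs i
  lookup≉ {xs = xs} x∉xs i =
    lookupₛ S (λ y≈z x≉y x≈z → x≉y (S.trans x≈z (S.sym y≈z))) x∉xs (∈-lookup S xs i)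

  lookup-injective : ∀ {xs} → Unique.Unique S xs → Injective _≡_ S._≈_ (lookup xs)
  lookup-injective (_ ∷ _) {zero} {zero} _ = refl
  lookup-injective {x ∷ xs} (x∉xs ∷ _) {zero} {suc j} eq =
    contradiction eq (lookup≉ x∉xs j)
  lookup-injective {x ∷ xs} (x∉xs ∷ _) {suc i} {zero} eq =
    contradiction (S.sym eq) (lookup≉ x∉xs i)
  lookup-injective (_ ∷ xs!) {suc i} {suc j} eq = cong suc (lookup-injective xs! eq)

-- Walks along the diagonals x + y = 0, 1, 2, …
next : ℕ × ℕ → ℕ × ℕ
next (zero  , y) = suc y , zero
next (suc x , y) = x , suc y

unpair : ℕ → ℕ × ℕ
unpair zero    = zero , zero
unpair (suc k) = next (unpair k)

-- The diagonal through `(i , j)` starts at `(j + i , 0)`, and `j` further steps reach the point.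
-- `axis` reaches each start from the end of the preceding diagonal.
unpair-surjective : ∀ i j → ∃[ k ] unpair k ≡ (i , j)
unpair-surjective i j = diagonal j (axis (j + i))
  where
  step : ∀ {p} → ∃[ k ] unpair k ≡ p → ∃[ k ] unpair k ≡ next p
  step (k , eq) = suc k , cong next eq

  diagonal : ∀ j {i} → ∃[ k ] unpair k ≡ (j + i , 0) → ∃[ k ] unpair k ≡ (i , j)
  diagonal zero        r = r
  diagonal (suc j) {i} r =
    step (diagonal j (subst (λ m → ∃[ k ] unpair k ≡ (m , 0)) (sym (+-suc j i)) r))

  axis : ∀ m → ∃[ k ] unpair k ≡ (m , 0)
  axis zero    = zero , refl
  axis (suc m) =
    step (diagonal m (subst (λ l → ∃[ k ] unpair k ≡ (l , 0)) (sym (+-identityʳ m)) (axis m)))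

-- Seeds: countable unions, transport between teams, determination of formulas.

module _ {n : ℕ} where

  -- A countable set of traces with property P; Maybe allows it to be empty.
  Seed : Pred (Trace n) 0ℓ → Set
  Seed P = ℕ → Maybe (Σ[ w ∈ Trace n ] P w)

  private variable P Q : Pred (Trace n) 0ℓ

  infix 4 _⊑_

  _⊑_ : Seed P → Pred (Trace n) 0ℓ → Set
  s ⊑ Q = ∀ k → All (Q ∘ proj₁) (s k)

  ⋃ : (ℕ → Seed P) → Seed P
  ⋃ s = uncurry s ∘ unpair

  ⋃-⊑ : (s : ℕ → Seed P) → ⋃ s ⊑ Q → ∀ i → s i ⊑ Q
  ⋃-⊑ s s⊑ i j with k , eq ← unpair-surjective i j =
    subst (λ p → All _ (uncurry s p)) eq (s⊑ k)

  -- `t` fills every index from 1 on, which makes binary union an instance of `⋃`.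
  pair : Seed P → Seed P → ℕ → Seed P
  pair s t zero    = s
  pair s t (suc _) = t

  infixr 6 _∪_

  _∪_ : Seed P → Seed P → Seed P
  s ∪ t = ⋃ (pair s t)

  ∪-⊑ˡ : (s t : Seed P) → s ∪ t ⊑ Q → s ⊑ Q
  ∪-⊑ˡ s t s∪t⊑ = ⋃-⊑ (pair s t) s∪t⊑ 0

  ∪-⊑ʳ : (s t : Seed P) → s ∪ t ⊑ Q → t ⊑ Q
  ∪-⊑ʳ s t s∪t⊑ = ⋃-⊑ (pair s t) s∪t⊑ 1

  -- Membership in `L ≥[ i ]` carries a trace of `L` with the given suffix, so a preimage is simply
  -- read off.
  unshift : ∀ i (L : Team n) → Seed (member (L ≥[ i ])) → Seed (member L)
  unshift i L s = map (λ (_ , w , w∈L , _) → w , w∈L) ∘ s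

  unshift-⊑ : ∀ i (L L′ : Team n) s → unshift i L s ⊑ member L′ → s ⊑ member (L′ ≥[ i ])
  unshift-⊑ i L L′ s s⊑ =
    All.map (λ { {_ , w , _ , v≗w} w∈L′ → w , w∈L′ , v≗w }) ∘ map⁻ ∘ s⊑

  ≥-mono : ∀ i (L L′ : Team n) → L ⊆ L′ → L ≥[ i ] ⊆ L′ ≥[ i ]
  ≥-mono i L L′ L⊆L′ = map₂ (map₁ L⊆L′)

  include : P U.⊆ Q → Seed P → Seed Q
  include P⊆Q = map (map₂ P⊆Q) ∘_

  _∩_ : Team n → Team n → Team n
  L ∩ L′ = record
    { member = member L U.∩ member L′
    ; resp   = λ w≗v → Product.map (resp L w≗v) (resp L′ w≗v)
    }

  -- Each trace of `s` carries its own proof of `P`, which survives the enlargement to `Q`.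
  include-⊑ : ∀ {R} (P⊆Q : P U.⊆ Q) (s : Seed P) → include P⊆Q s ⊑ R → s ⊑ R U.∩ P
  include-⊑ P⊆Q s s⊑ = All.map (λ { {_ , w∈P} w∈R → w∈R , w∈P }) ∘ map⁻ ∘ s⊑

  -- An equivalence, since truth has to transfer both ways under `∼` and in the premise of `⇒`.
  Determines : ∀ L → Seed (member L) → Formula n → Set₁
  Determines L s φ = ∀ L′ → s ⊑ member L′ → L′ ⊆ L → (L′ ⊨ φ) ⇔ (L ⊨ φ)

  DeterminesSuffixes : ∀ L → Seed (member L) → Formula n → Set₁
  DeterminesSuffixes L s φ =
    ∀ L′ → s ⊑ member L′ → L′ ⊆ L → ∀ i → (L′ ≥[ i ] ⊨ φ) ⇔ (L ≥[ i ] ⊨ φ)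

  -- There are countably many offsets, so the seeds of all `L ≥[ i ]`, pulled back to `L`, unite to
  -- one seed. Hence `ih` must speak of all teams, not of `L` alone.
  determinesSuffixes : ∀ φ → (∀ L → Σ[ s ∈ Seed (member L) ] Determines L s φ) →
                       ∀ L → Σ[ s ∈ Seed (member L) ] DeterminesSuffixes L s φ
  determinesSuffixes φ ih L = ⋃ seeds , λ L′ s⊑L′ L′⊆L i →
    proj₂ (ih (L ≥[ i ])) (L′ ≥[ i ])
      (unshift-⊑ i L L′ (proj₁ (ih (L ≥[ i ]))) (⋃-⊑ seeds s⊑L′ i))
      (≥-mono i L′ L L′⊆L)
    where
    seeds : ℕ → Seed (member L)
    seeds i = unshift i L (proj₁ (ih (L ≥[ i ])))

-- Existence of determining seeds.

module _ (em : ExcludedMiddle (lsuc 0ℓ)) where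

  em₀ : ExcludedMiddle 0ℓ
  em₀ = Dec.map′ lower lift (em {Lift (lsuc 0ℓ) _})

  module _ {n : ℕ} where

    determined : ∀ (φ : Formula n) L → Σ[ s ∈ Seed (member L) ] Determines L s φ
    determined bot L with em₀ {∃[ w ] w ∈ L}
    -- One trace keeps every intermediate team nonempty.
    ... | yes x@(w , w∈L) = const (just x) , λ L′ s⊑L′ L′⊆L → mk⇔
      (λ (lift L′-empty) → contradiction (drop-just (s⊑L′ 0)) (L′-empty w))
      (λ (lift L-empty) → contradiction w∈L (L-empty w))
    ... | no L-empty = const nothing , λ L′ s⊑L′ L′⊆L → mk⇔
      (λ _ → lift λ w w∈L → L-empty (w , w∈L))
      (λ _ → lift λ w w∈L′ → L-empty (w , L′⊆L w∈L′))
    determined (atom p) L with em₀ {∃[ w ] w ∈ L × ¬ p ∈ₛ w 0}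
    -- One counterexample to `p` refutes it in every intermediate team.
    ... | yes (w , w∈L , p∉w) = const (just (w , w∈L)) , λ L′ s⊑L′ L′⊆L → mk⇔
      (λ (lift L′⊨p) → contradiction (L′⊨p w (drop-just (s⊑L′ 0))) p∉w)
      (λ (lift L⊨p) → contradiction (L⊨p w w∈L) p∉w)
    ... | no L⊨p = const nothing , λ L′ s⊑L′ L′⊆L → mk⇔
      (λ _ → lift holds)
      (λ _ → lift λ w w∈L′ → holds w (L′⊆L w∈L′))
      where
      holds : ∀ w → w ∈ L → p ∈ₛ w 0
      holds w w∈L = decidable-stable em₀ λ p∉w → L⊨p (w , w∈L , p∉w)
    determined (φ ∨ᵇ ψ) L
      with s , φ-det ← determined φ L | t , ψ-det ← determined ψ L =
      s ∪ t , λ L′ s∪t⊑L′ L′⊆L →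
        φ-det L′ (∪-⊑ˡ s t s∪t⊑L′) L′⊆L ⊎-⇔ ψ-det L′ (∪-⊑ʳ s t s∪t⊑L′) L′⊆L
    determined (φ ∧ ψ) L
      with s , φ-det ← determined φ L | t , ψ-det ← determined ψ L =
      s ∪ t , λ L′ s∪t⊑L′ L′⊆L →
        φ-det L′ (∪-⊑ˡ s t s∪t⊑L′) L′⊆L ×-⇔ ψ-det L′ (∪-⊑ʳ s t s∪t⊑L′) L′⊆L
    determined (φ ⇒ ψ) L
      with em {Σ[ L₁ ∈ Team n ] (L₁ ⊆ L × L₁ ⊨ φ × ¬ L₁ ⊨ ψ)}
    -- A valid implication passes to all subteams, so the empty seed is enough.
    ... | no valid = const nothing , λ L′ _ L′⊆L → mk⇔
      (λ _ → holds)
      (λ _ L₁ L₁⊆L′ → holds L₁ λ w∈L₁ → L′⊆L (L₁⊆L′ w∈L₁))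
      where
      holds : L ⊨ φ ⇒ ψ
      holds L₁ L₁⊆L L₁⊨φ = decidable-stable em λ L₁⊭ψ → valid (L₁ , L₁⊆L , L₁⊨φ , L₁⊭ψ)
    ... | yes (L₁ , L₁⊆L , L₁⊨φ , L₁⊭ψ)
      with s , φ-det ← determined φ L₁ | t , ψ-det ← determined ψ L₁ =
      include L₁⊆L (s ∪ t) , λ L′ s∪t⊑L′ L′⊆L →
        let s∪t⊑ = include-⊑ L₁⊆L (s ∪ t) s∪t⊑L′
            -- `L′ ∩ L₁` lies between the seeds and `L₁`, so `φ` descends to it from `L₁`, while `ψ`
            -- would ascend from it to `L₁`.
            to-φ = from (φ-det (L′ ∩ L₁) (∪-⊑ˡ s t s∪t⊑) proj₂)
            to-ψ = to (ψ-det (L′ ∩ L₁) (∪-⊑ʳ s t s∪t⊑) proj₂)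
        in mk⇔
          (λ L′⊨ → contradiction (to-ψ (L′⊨ (L′ ∩ L₁) proj₁ (to-φ L₁⊨φ))) L₁⊭ψ)
          (λ L⊨ → contradiction (L⊨ L₁ L₁⊆L L₁⊨φ) L₁⊭ψ)
    determined (𝖷 φ) L =
      map₂ (λ det L′ s⊑L′ L′⊆L → det L′ s⊑L′ L′⊆L 1) (determinesSuffixes φ (determined φ) L)
    determined (φ 𝖴 ψ) L
      with s , φ-det ← determinesSuffixes φ (determined φ) L
         | t , ψ-det ← determinesSuffixes ψ (determined ψ) L =
      s ∪ t , λ L′ s∪t⊑L′ L′⊆L →
        let φ⇔ = φ-det L′ (∪-⊑ˡ s t s∪t⊑L′) L′⊆L
            ψ⇔ = ψ-det L′ (∪-⊑ʳ s t s∪t⊑L′) L′⊆L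
        in mk⇔
          -- The same `i` is a witness on both sides, as one seed settles all offsets.
          (map₂ λ {i} → Product.map (to (ψ⇔ i)) λ φs k k<i → to (φ⇔ k) (φs k k<i))
          (map₂ λ {i} → Product.map (from (ψ⇔ i)) λ φs k k<i → from (φ⇔ k) (φs k k<i))
    determined (φ 𝖱 ψ) L
      with s , φ-det ← determinesSuffixes φ (determined φ) L
         | t , ψ-det ← determinesSuffixes ψ (determined ψ) L =
      s ∪ t , λ L′ s∪t⊑L′ L′⊆L →
        let φ⇔ = φ-det L′ (∪-⊑ˡ s t s∪t⊑L′) L′⊆L
            ψ⇔ = ψ-det L′ (∪-⊑ʳ s t s∪t⊑L′) L′⊆L
        in mk⇔
          (λ L′⊨ i → Sum.map (to (ψ⇔ i)) (map₂ λ {k} → map₂ (to (φ⇔ k))) (L′⊨ i))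
          (λ L⊨ i → Sum.map (from (ψ⇔ i)) (map₂ λ {k} → map₂ (from (φ⇔ k))) (L⊨ i))
    determined (∼ φ) L =
      map₂ (λ det L′ s⊑L′ L′⊆L → ¬-cong-⇔ (det L′ s⊑L′ L′⊆L)) (determined φ L)

    -- Padding a seed to an injective sequence.

    module _ (L : Team n) (uncountable : Uncountable L) where

      private
        S : Setoid 0ℓ 0ℓ
        S = elements L
        module S = Setoid S

        S? : DecSetoid 0ℓ 0ℓ
        S? = record
          { isDecEquivalence = record { isEquivalence = S.isEquivalence ; _≟_ = λ _ _ → em₀ } }

      open Membership S using () renaming (_∈_ to _∈ₗ_; _∉_ to _∉ₗ_)

      -- Removing the duplicates from such a list would give a bijection from some `Fin k`, making
      -- `L` finite.
      ¬enumeration : ∀ xs → ¬ IsEnumeration S xs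
      ¬enumeration xs enum = uncountable (inj₁ (length ys , record
        { to        = lookup ys
        ; cong      = λ { {i} refl → S.refl {lookup ys i} }
        ; bijective = lookup-injective S (deduplicate-! S? xs)
                    , lookup-surjective S (deduplicate⁺ S? enum)
        }))
        where ys = deduplicate (λ _ _ → em₀) xs

      fresh : ∀ xs → ∃[ x ] x ∉ₗ xs
      fresh xs = decidable-stable em₀ λ none →
        ¬enumeration xs λ x → decidable-stable em₀ λ x∉xs → none (x , x∉xs)

      -- The new entry is the one proposed by `m` if there is one not yet listed, and a fresh trace
      -- otherwise.
      extend : ∀ xs m → Σ[ x ∈ S.Carrier ] (x ∉ₗ xs × All (_∈ₗ x ∷ xs) m)
      extend xs nothing with x , x∉xs ← fresh xs = x , x∉xs , nothing
      extend xs (just y) with em₀ {y ∈ₗ xs}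
      ... | no y∉xs = y , y∉xs , just (here (S.refl {y}))
      ... | yes y∈xs with x , x∉xs ← fresh xs = x , x∉xs , just (there y∈xs)

      module _ (s : Seed (member L)) where

        -- The recursion is mutual so that stage `k` can avoid all traces chosen earlier.
        prefix : ℕ → List S.Carrier
        padded : ℕ → S.Carrier
        prefix zero    = []
        prefix (suc k) = padded k ∷ prefix k
        padded k = proj₁ (extend (prefix k) (s k))

        padded∉prefix : ∀ k → padded k ∉ₗ prefix k
        padded∉prefix k = proj₁ (proj₂ (extend (prefix k) (s k)))

        seed⊆prefix : ∀ k → All (_∈ₗ prefix (suc k)) (s k)
        seed⊆prefix k = proj₂ (proj₂ (extend (prefix k) (s k)))

        ∈-prefix⁺ : ∀ x {i j} → i < j → x S.≈ padded i → x ∈ₗ prefix j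
        ∈-prefix⁺ x {j = suc j} i<1+j x≈ with m<1+n⇒m<n∨m≡n i<1+j
        ... | inj₁ i<j  = there (∈-prefix⁺ x i<j x≈)
        ... | inj₂ refl = here x≈

        ∈-prefix⁻ : ∀ x j → x ∈ₗ prefix j → ∃[ i ] x S.≈ padded i
        ∈-prefix⁻ x (suc j) (here x≈)  = j , x≈
        ∈-prefix⁻ x (suc j) (there x∈) = ∈-prefix⁻ x j x∈

        -- Of two distinct indices, the entry at the smaller lies in the prefix of the larger, which
        -- the larger entry avoids.
        padded-injective : Injective _≡_ S._≈_ padded
        padded-injective {i} {j} eq with <-cmp i j
        ... | tri< i<j _ _ =
          contradiction (∈-prefix⁺ (padded j) i<j (S.sym {padded i} {padded j} eq)) (padded∉prefix j)
        ... | tri≈ _ i≡j _ = i≡j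
        ... | tri> _ _ j<i = contradiction (∈-prefix⁺ (padded i) j<i eq) (padded∉prefix i)

        range : Team n
        range = record
          { member = λ w → ∃[ k ] w ≗ proj₁ (padded k)
          ; resp   = λ w≗v (k , w≗) → k , λ i → trans (sym (w≗v i)) (w≗ i)
          }

        range⊆L : range ⊆ L
        range⊆L (k , w≗) = resp L (λ i → sym (w≗ i)) (proj₂ (padded k))

        range-countable : CountablyInfinite range
        range-countable = record
          { to        = λ k → proj₁ (padded k) , k , λ _ → refl
          ; cong      = λ { refl _ → refl }
          ; bijective = padded-injective
                      , λ (_ , k , w≗) → k , λ { refl i → sym (w≗ i) }
          }

        seed⊑range : s ⊑ member range
        -- `s k` is only sure to be listed after stage `k`, hence the index `suc k`.
        seed⊑range k = All.map (λ {x} → ∈-prefix⁻ x (suc k)) (seed⊆prefix k)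

proposition2 : ExcludedMiddle (lsuc 0ℓ) →
    ∀ {n : ℕ} (φ : Formula n) (Lᵤ : Team n) → Uncountable Lᵤ → Lᵤ ⊨ φ →
    Σ[ Lc ∈ Team n ]
    (Countable Lc × Lc ⊨ φ × Lc ⊆ Lᵤ ×
    (∀ (L : Team n) → Lc ⊆ L → L ⊆ Lᵤ → L ⊨ φ))
proposition2 em φ Lᵤ uncountable Lᵤ⊨φ with s , det ← determined em φ Lᵤ =
  -- `Lc` itself is the least of the intermediate teams, so `between` also yields its satisfaction
  -- of `φ`.
  Lc , inj₂ (range-countable em Lᵤ uncountable s) , between Lc id Lc⊆Lᵤ , Lc⊆Lᵤ , between
  where
  Lc = range em Lᵤ uncountable s

  Lc⊆Lᵤ : Lc ⊆ Lᵤ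
  Lc⊆Lᵤ = range⊆L em Lᵤ uncountable s

  between : ∀ L → Lc ⊆ L → L ⊆ Lᵤ → L ⊨ φ
  between L Lc⊆L L⊆Lᵤ =
    from (det L (All.map Lc⊆L ∘ seed⊑range em Lᵤ uncountable s) L⊆Lᵤ) Lᵤ⊨φ
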